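{- For every integer $n \ge 3$ there exist $m = n$ real symmetric positive semidefinite matrices $A_1,\dots,A_m \in \mathbb{R}^{4n\times 4n}$, each of rank $2n$, such that for every proper subset $U \subsetneq [m]$ there is a vector $x \in \mathbb{R}^{4n}$ with $x^\top A_i x = 0$ for every $i\in U$ and $x^\top\left(\sum_{i\in[m]}A_i\right)x > 0$. Consequently, for every $\varepsilon<1$ and every $\mu:[m]\to\mathbb{R}_{\ge 0}$ whose support is a proper subset of $[m]$, the matrix $\sum_{i\in[m]}\mu_iA_i$ does not satisfy $(1-\varepsilon)\sum_{i\in [m]}A_i\preceq\sum_{i\in[m]}\mu_iA_i\preceq(1+\varepsilon)\sum_{i\in[m]}A_i$.
   Context: $[m]=\{1,\dots,m\}$. For symmetric matrices, $A\preceq B$ means $B-A$ is positive semidefinite. -}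

module Defs where

open import Algebra.Bundles.Raw using (RawRing)
import Algebra.Definitions.RawMonoid as RawMonoidDefs
open import Data.Fin.Base using (Fin)
open import Data.Nat.Base as ℕ using (ℕ)
import Data.Nat.Properties as ℕ
open import Data.Product.Base using (Σ-syntax; ∃-syntax; _×_; _,_)
open import Data.Rational.Base as ℚ using (ℚ; 0ℚ; 1ℚ; ½; ∣_∣)
import Data.Rational.Properties as ℚ
open import Data.Rational.Solver using (module +-*-Solver)
open import Data.Vec.Functional using (Vector; transpose)
open import Level using (0ℓ)
open import Relation.Binary.PropositionalEquality using (_≡_; refl; sym; trans; cong; subst; module ≡-Reasoning)
open import Relation.Nullary using (¬_)
open import Relation.Unary using (Pred; _∈_; _⊆_)

------------------------------------------------------------------------
-- Real numbers: Cauchy sequences of rationals, compared up to _≈_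

Eventually : Pred ℕ 0ℓ → Set
Eventually P = ∃[ N ] (∀ {n} → N ℕ.≤ n → P n)

IsCauchy : (ℕ → ℚ) → Set
IsCauchy x = ∀ {ε} → 0ℚ ℚ.< ε →
  ∃[ N ] (∀ {m n} → N ℕ.≤ m → N ℕ.≤ n → ∣ x m ℚ.- x n ∣ ℚ.< ε)

record ℝ : Set where
  constructor mkℝ
  field
    seq      : ℕ → ℚ
    isCauchy : IsCauchy seq

open ℝ public

infix 4 _≈_ _≤_ _<_

_≈_ : ℝ → ℝ → Set
x ≈ y = ∀ {ε} → 0ℚ ℚ.< ε → Eventually λ n → ∣ seq x n ℚ.- seq y n ∣ ℚ.< ε

_<_ : ℝ → ℝ → Set
x < y = ∃[ ε ] (0ℚ ℚ.< ε × Eventually λ n → seq x n ℚ.+ ε ℚ.≤ seq y n)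

-- The slack ε is needed: x and y may have the same limit while
-- seq x stays strictly above seq y.
_≤_ : ℝ → ℝ → Set
x ≤ y = ∀ {ε} → 0ℚ ℚ.< ε → Eventually λ n → seq x n ℚ.≤ seq y n ℚ.+ ε

abstract

  const-cauchy : ∀ q → IsCauchy (λ _ → q)
  const-cauchy q {ε} 0<ε = 0 , λ _ _ →
    subst (ℚ._< ε) (sym (cong ∣_∣ (ℚ.+-inverseʳ q))) 0<ε

  neg-cauchy : ∀ {x} → IsCauchy x → IsCauchy (λ n → ℚ.- x n)
  neg-cauchy {x} cx {ε} 0<ε with cx 0<ε
  ... | N , p = N , λ {m} {n} N≤m N≤n →
    subst (ℚ._< ε)
      (trans (sym (ℚ.∣-p∣≡∣p∣ (x m ℚ.- x n)))
             (cong ∣_∣ (ℚ.neg-distrib-+ (x m) (ℚ.- x n))))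
      (p N≤m N≤n)

  +-cauchy : ∀ {x y} → IsCauchy x → IsCauchy y → IsCauchy (λ n → x n ℚ.+ y n)
  +-cauchy {x} {y} cx cy {ε} 0<ε
    with cx 0<½ε | cy 0<½ε
    where
    0<½ε : 0ℚ ℚ.< ½ ℚ.* ε
    0<½ε = subst (ℚ._< ½ ℚ.* ε) (ℚ.*-zeroʳ ½) (ℚ.*-monoʳ-<-pos ½ 0<ε)
  ... | M , p | N , q = M ℕ.⊔ N , λ {m} {n} K≤m K≤n → begin-strict
    ∣ (x m ℚ.+ y m) ℚ.- (x n ℚ.+ y n) ∣            ≡⟨ cong ∣_∣ (rearrange (x m) (y m) (x n) (y n)) ⟩
    ∣ (x m ℚ.- x n) ℚ.+ (y m ℚ.- y n) ∣            ≤⟨ ℚ.∣p+q∣≤∣p∣+∣q∣ (x m ℚ.- x n) (y m ℚ.- y n) ⟩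
    ∣ x m ℚ.- x n ∣ ℚ.+ ∣ y m ℚ.- y n ∣            <⟨ ℚ.+-mono-<
                                                        (p (ℕ.m⊔n≤o⇒m≤o M N K≤m) (ℕ.m⊔n≤o⇒m≤o M N K≤n))
                                                        (q (ℕ.m⊔n≤o⇒n≤o M N K≤m) (ℕ.m⊔n≤o⇒n≤o M N K≤n)) ⟩
    ½ ℚ.* ε ℚ.+ ½ ℚ.* ε                            ≡⟨ ℚ.*-distribʳ-+ ε ½ ½ ⟨
    1ℚ ℚ.* ε                                       ≡⟨ ℚ.*-identityˡ ε ⟩
    ε                                              ∎
    where
    open ℚ.≤-Reasoning
    rearrange : ∀ a b c d → (a ℚ.+ b) ℚ.- (c ℚ.+ d) ≡ (a ℚ.- c) ℚ.+ (b ℚ.- d)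
    rearrange = solve 4 (λ a b c d → (a :+ b) :- (c :+ d) := (a :- c) :+ (b :- d)) refl
      where open +-*-Solver

  cauchy-bounded : ∀ {x} → IsCauchy x →
    ∃[ B ] (0ℚ ℚ.< B × Eventually λ n → ∣ x n ∣ ℚ.≤ B)
  cauchy-bounded {x} cx with cx (ℚ.positive⁻¹ 1ℚ)
  ... | N , p = 1ℚ ℚ.+ ∣ x N ∣
              , ℚ.+-mono-<-≤ (ℚ.positive⁻¹ 1ℚ) (ℚ.0≤∣p∣ (x N))
              , N , λ {n} N≤n → begin
    ∣ x n ∣                        ≡⟨ cong ∣_∣ (split (x n) (x N)) ⟩
    ∣ (x n ℚ.- x N) ℚ.+ x N ∣      ≤⟨ ℚ.∣p+q∣≤∣p∣+∣q∣ (x n ℚ.- x N) (x N) ⟩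
    ∣ x n ℚ.- x N ∣ ℚ.+ ∣ x N ∣    ≤⟨ ℚ.+-monoˡ-≤ ∣ x N ∣ (ℚ.<⇒≤ (p N≤n ℕ.≤-refl)) ⟩
    1ℚ ℚ.+ ∣ x N ∣                 ∎
    where
    open ℚ.≤-Reasoning
    split : ∀ a b → a ≡ (a ℚ.- b) ℚ.+ b
    split = solve 2 (λ a b → a := (a :- b) :+ b) refl
      where open +-*-Solver

  divide : ∀ {B ε} → 0ℚ ℚ.< B → 0ℚ ℚ.< ε → ∃[ δ ] (0ℚ ℚ.< δ × B ℚ.* δ ≡ ε)
  divide {B} {ε} 0<B 0<ε = B⁻¹ ℚ.* ε , 0<B⁻¹ε , (begin
    B ℚ.* (B⁻¹ ℚ.* ε)    ≡⟨ ℚ.*-assoc B B⁻¹ ε ⟨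
    (B ℚ.* B⁻¹) ℚ.* ε    ≡⟨ cong (ℚ._* ε) (ℚ.*-inverseʳ B {{B≢0}}) ⟩
    1ℚ ℚ.* ε             ≡⟨ ℚ.*-identityˡ ε ⟩
    ε                    ∎)
    where
    open ≡-Reasoning
    B≢0 : ℚ.NonZero B
    B≢0 = ℚ.>-nonZero 0<B
    B⁻¹ : ℚ
    B⁻¹ = ℚ.1/_ B {{B≢0}}
    0<B⁻¹ε : 0ℚ ℚ.< B⁻¹ ℚ.* ε
    0<B⁻¹ε = ℚ.positive⁻¹ _
      {{ℚ.pos*pos⇒pos B⁻¹ {{ℚ.1/pos⇒pos B {{ℚ.positive 0<B}}}} ε {{ℚ.positive 0<ε}}}}

  ∣*∣-bound : ∀ {a e E δ} → 0ℚ ℚ.< E → ∣ a ∣ ℚ.≤ E → ∣ e ∣ ℚ.< δ → ∣ a ℚ.* e ∣ ℚ.< E ℚ.* δ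
  ∣*∣-bound {a} {e} {E} {δ} 0<E ∣a∣≤E ∣e∣<δ = begin-strict
    ∣ a ℚ.* e ∣      ≡⟨ ℚ.∣p*q∣≡∣p∣*∣q∣ a e ⟩
    ∣ a ∣ ℚ.* ∣ e ∣  ≤⟨ ℚ.*-monoʳ-≤-nonNeg ∣ e ∣ {{ℚ.nonNegative (ℚ.0≤∣p∣ e)}} ∣a∣≤E ⟩
    E ℚ.* ∣ e ∣      <⟨ ℚ.*-monoʳ-<-pos E {{ℚ.positive 0<E}} ∣e∣<δ ⟩
    E ℚ.* δ          ∎
    where open ℚ.≤-Reasoning

  *-estimate : ∀ {B C δ} a b c d → 0ℚ ℚ.< B → 0ℚ ℚ.< C →
    ∣ a ∣ ℚ.≤ B → ∣ d ∣ ℚ.≤ C → ∣ a ℚ.- c ∣ ℚ.< δ → ∣ b ℚ.- d ∣ ℚ.< δ →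
    ∣ a ℚ.* b ℚ.- c ℚ.* d ∣ ℚ.< (B ℚ.+ C) ℚ.* δ
  *-estimate {B} {C} {δ} a b c d 0<B 0<C ∣a∣≤B ∣d∣≤C ∣a-c∣<δ ∣b-d∣<δ = begin-strict
    ∣ a ℚ.* b ℚ.- c ℚ.* d ∣                              ≡⟨ cong ∣_∣ (split a b c d) ⟩
    ∣ a ℚ.* (b ℚ.- d) ℚ.+ d ℚ.* (a ℚ.- c) ∣              ≤⟨ ℚ.∣p+q∣≤∣p∣+∣q∣ (a ℚ.* (b ℚ.- d)) (d ℚ.* (a ℚ.- c)) ⟩
    ∣ a ℚ.* (b ℚ.- d) ∣ ℚ.+ ∣ d ℚ.* (a ℚ.- c) ∣          <⟨ ℚ.+-mono-<
                                                              (∣*∣-bound {a} {b ℚ.- d} 0<B ∣a∣≤B ∣b-d∣<δ)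
                                                              (∣*∣-bound {d} {a ℚ.- c} 0<C ∣d∣≤C ∣a-c∣<δ) ⟩
    B ℚ.* δ ℚ.+ C ℚ.* δ                                  ≡⟨ ℚ.*-distribʳ-+ δ B C ⟨
    (B ℚ.+ C) ℚ.* δ                                      ∎
    where
    open ℚ.≤-Reasoning
    split : ∀ a b c d → a ℚ.* b ℚ.- c ℚ.* d ≡ a ℚ.* (b ℚ.- d) ℚ.+ d ℚ.* (a ℚ.- c)
    split = solve 4 (λ a b c d → a :* b :- c :* d := a :* (b :- d) :+ d :* (a :- c)) refl
      where open +-*-Solver

  *-cauchy : ∀ {x y} → IsCauchy x → IsCauchy y → IsCauchy (λ n → x n ℚ.* y n)
  *-cauchy {x} {y} cx cy {ε} 0<ε =
    let B , 0<B , L , ∣x∣≤B = cauchy-bounded cx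
        C , 0<C , K , ∣y∣≤C = cauchy-bounded cy
        δ , 0<δ , [B+C]δ≡ε = divide (ℚ.+-mono-< 0<B 0<C) 0<ε
        M , p = cx 0<δ
        N , q = cy 0<δ
    in (L ℕ.⊔ K) ℕ.⊔ (M ℕ.⊔ N) , λ {m} {n} h h′ →
      let LK≤m = ℕ.m⊔n≤o⇒m≤o (L ℕ.⊔ K) (M ℕ.⊔ N) h
          LK≤n = ℕ.m⊔n≤o⇒m≤o (L ℕ.⊔ K) (M ℕ.⊔ N) h′
          MN≤m = ℕ.m⊔n≤o⇒n≤o (L ℕ.⊔ K) (M ℕ.⊔ N) h
          MN≤n = ℕ.m⊔n≤o⇒n≤o (L ℕ.⊔ K) (M ℕ.⊔ N) h′
      in subst (∣ x m ℚ.* y m ℚ.- x n ℚ.* y n ∣ ℚ.<_) [B+C]δ≡ε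
           (*-estimate (x m) (y m) (x n) (y n) 0<B 0<C
             (∣x∣≤B (ℕ.m⊔n≤o⇒m≤o L K LK≤m))
             (∣y∣≤C (ℕ.m⊔n≤o⇒n≤o L K LK≤n))
             (p (ℕ.m⊔n≤o⇒m≤o M N MN≤m) (ℕ.m⊔n≤o⇒m≤o M N MN≤n))
             (q (ℕ.m⊔n≤o⇒n≤o M N MN≤m) (ℕ.m⊔n≤o⇒n≤o M N MN≤n)))

infix  8 -_
infixl 7 _*_
infixl 6 _+_ _-_

fromℚ : ℚ → ℝ
fromℚ q = mkℝ (λ _ → q) (const-cauchy q)

0ℝ 1ℝ : ℝ
0ℝ = fromℚ 0ℚ
1ℝ = fromℚ 1ℚ

-_ : ℝ → ℝ
- x = mkℝ (λ n → ℚ.- seq x n) (neg-cauchy {seq x} (isCauchy x))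

_+_ _*_ _-_ : ℝ → ℝ → ℝ
x + y = mkℝ (λ n → seq x n ℚ.+ seq y n) (+-cauchy {seq x} {seq y} (isCauchy x) (isCauchy y))
x * y = mkℝ (λ n → seq x n ℚ.* seq y n) (*-cauchy {seq x} {seq y} (isCauchy x) (isCauchy y))
x - y = x + (- y)

+-*-rawRing : RawRing 0ℓ 0ℓ
+-*-rawRing = record
  { Carrier = ℝ ; _≈_ = _≈_ ; _+_ = _+_ ; _*_ = _*_ ; -_ = -_ ; 0# = 0ℝ ; 1# = 1ℝ }

open RawMonoidDefs (RawRing.+-rawMonoid +-*-rawRing) public using (sum)

------------------------------------------------------------------------
-- Linear algebra

Matrix : ℕ → ℕ → Set
Matrix m n = Vector (Vector ℝ n) m

private
  variable
    d k m n : ℕ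

infix 4 _≈ᵛ_

_≈ᵛ_ : Vector ℝ d → Vector ℝ d → Set
u ≈ᵛ v = ∀ i → u i ≈ v i

0ᵛ : Vector ℝ d
0ᵛ _ = 0ℝ

linComb : Vector ℝ k → Vector (Vector ℝ d) k → Vector ℝ d
linComb c b i = sum λ j → c j * b j i

Span : Vector (Vector ℝ d) k → Pred (Vector ℝ d) 0ℓ
Span b v = ∃[ c ] v ≈ᵛ linComb c b

LinearlyIndependent : Vector (Vector ℝ d) k → Set
LinearlyIndependent b = ∀ c → linComb c b ≈ᵛ 0ᵛ → c ≈ᵛ 0ᵛ

-- The column space, spanned by the rows of the transpose, has a basis
-- of r vectors.
HasRank : Matrix m n → ℕ → Set
HasRank {m} A r = Σ[ b ∈ Vector (Vector ℝ m) r ]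
  ( LinearlyIndependent b
  × (∀ j → b j ∈ Span (transpose A))
  × Span (transpose A) ⊆ Span b )

Symmetric : Matrix d d → Set
Symmetric A = ∀ i j → A i j ≈ A j i

-- quad A x is xᵀ A x.
quad : Matrix d d → Vector ℝ d → ℝ
quad A x = sum λ i → sum λ j → x i * A i j * x j

PositiveSemidefinite : Matrix d d → Set
PositiveSemidefinite A = Symmetric A × (∀ x → 0ℝ ≤ quad A x)

infixl 6 _-ᴹ_
infixr 7 _·ᴹ_
infix  4 _⪯_

_-ᴹ_ : Matrix m n → Matrix m n → Matrix m n
(A -ᴹ B) i j = A i j - B i j

_·ᴹ_ : ℝ → Matrix m n → Matrix m n
(c ·ᴹ A) i j = c * A i j

sumᴹ : Vector (Matrix m n) k → Matrix m n
sumᴹ A i j = sum λ l → A l i j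

_⪯_ : Matrix d d → Matrix d d → Set
A ⪯ B = PositiveSemidefinite (B -ᴹ A)

support : Vector ℝ k → Pred (Fin k) 0ℓ
support μ i = ¬ (μ i ≈ 0ℝ)

{-# OPTIONS --safe #-}

-- Coordinates of ℝ⁴ⁿ are pairs (a , j) with a ∈ Fin 4 and j ∈ Fin n.
-- Aᵢ is the orthogonal projection onto the 2n coordinates (0 , i), (1 , i) and
-- (2 , j), (3 , j) for j ≠ i.  The unit vector at (0 , i) is fixed by Aᵢ and
-- annihilated by every other A_l, so no Aᵢ can be dropped: as soon as i ∉ U that
-- vector separates, and evaluating (1 - ε) ∑ A ⪯ ∑ μ A on it gives 1 - ε ≤ μᵢ.
-- All identities between reals needed here hold termwise in the representing
-- rational sequences.
module Submission where

open import Defs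
open import Algebra.Bundles using (CommutativeRing)
open import Data.Nat.Base using (ℕ) renaming (_*_ to _*ℕ_; _≥_ to _≥ℕ_)
import Data.Nat.Base as ℕ
import Data.Nat.Properties as ℕ
open import Data.Bool.Base using (Bool; true; false; if_then_else_)
open import Data.Fin.Base using (Fin; zero; suc; _↑ˡ_; _↑ʳ_; combine; remQuot)
open import Data.Fin.Properties using
  (_≟_; ↑ˡ-injective; ↑ʳ-injective; combine-injective; combine-remQuot; remQuot-combine)
open import Data.Fin.Subset using (Subset; ⊤) renaming (_∈_ to _∈ₛ_; _⊂_ to _⊂ₛ_)
open import Data.Product.Base using (Σ-syntax; ∃-syntax; _×_; _,_; proj₁; proj₂; uncurry)
open import Data.Rational.Base as ℚ using (ℚ; 0ℚ; 1ℚ; ½; ∣_∣)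
import Data.Rational.Properties as ℚ
open import Data.Rational.Solver using (module +-*-Solver)
open import Data.Sum.Base using (inj₁; inj₂)
open import Data.Vec.Functional using (Vector; transpose)
open import Function.Base using (_∘_)
open import Function.Definitions using (Injective)
open import Relation.Binary.PropositionalEquality using
  (_≡_; _≢_; refl; sym; trans; cong; cong₂; subst; module ≡-Reasoning)
open import Relation.Nullary using (¬_; yes; no; does)
open import Relation.Nullary.Decidable using (dec-true; dec-false)
open import Relation.Unary using (U; _⊂_; _∈_; _⊆_)

import Algebra.Properties.Semiring.Sum (CommutativeRing.semiring ℚ.+-*-commutativeRing) as ℚ∑
import Algebra.Properties.CommutativeMonoid.Sum
  (CommutativeRing.+-commutativeMonoid ℚ.+-*-commutativeRing) as ℚ∑ᶜ

private
  variable
    d n r : ℕ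

-- Rational sums and the Kronecker delta

δ : Fin d → Fin d → ℚ
δ i j = if does (i ≟ j) then 1ℚ else 0ℚ

δ-refl : (i : Fin d) → δ i i ≡ 1ℚ
δ-refl i = cong (if_then 1ℚ else 0ℚ) (dec-true (i ≟ i) refl)

δ-≢ : {i j : Fin d} → i ≢ j → δ i j ≡ 0ℚ
δ-≢ {i = i} {j} i≢j = cong (if_then 1ℚ else 0ℚ) (dec-false (i ≟ j) i≢j)

-- The indices come out swapped so that the fixed one stands first, the shape that `∑-δʳ` collapses.
δ-injective : {σ : Fin r → Fin d} → Injective _≡_ _≡_ σ → ∀ i j → δ (σ i) (σ j) ≡ δ j i
δ-injective {σ = σ} σ-inj i j with j ≟ i
... | yes refl = δ-refl (σ i)
... | no j≢i   = δ-≢ (j≢i ∘ sym ∘ σ-inj)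

∑-zero : {f : Vector ℚ d} → (∀ i → f i ≡ 0ℚ) → ℚ∑.sum f ≡ 0ℚ
∑-zero {d} f≡0 = trans (ℚ∑.sum-cong-≗ f≡0) (ℚ∑.sum-replicate-zero d)

∑-δˡ : ∀ (p : Fin d) (f : Vector ℚ d) → ℚ∑.sum (λ l → δ p l ℚ.* f l) ≡ f p
∑-δˡ zero f = trans
  (cong₂ ℚ._+_ (ℚ.*-identityˡ (f zero)) (∑-zero (ℚ.*-zeroˡ ∘ f ∘ suc)))
  (ℚ.+-identityʳ (f zero))
∑-δˡ (suc p) f = trans
  (cong₂ ℚ._+_ (ℚ.*-zeroˡ (f zero)) (∑-δˡ p (f ∘ suc)))
  (ℚ.+-identityˡ (f (suc p)))

∑-δʳ : ∀ (p : Fin d) (f : Vector ℚ d) → ℚ∑.sum (λ l → f l ℚ.* δ p l) ≡ f p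
∑-δʳ p f = trans (ℚ∑.sum-cong-≗ λ l → ℚ.*-comm (f l) (δ p l)) (∑-δˡ p f)

∑-nonNeg : {f : Vector ℚ d} → (∀ i → 0ℚ ℚ.≤ f i) → 0ℚ ℚ.≤ ℚ∑.sum f
∑-nonNeg {ℕ.zero}  _   = ℚ.≤-refl
∑-nonNeg {ℕ.suc d} 0≤f = ℚ.+-mono-≤ (0≤f zero) (∑-nonNeg (0≤f ∘ suc))

square-nonNeg : ∀ q → 0ℚ ℚ.≤ q ℚ.* q
square-nonNeg q with ℚ.≤-total 0ℚ q
... | inj₁ 0≤q = ℚ.nonNegative⁻¹ _
  {{ℚ.nonNeg*nonNeg⇒nonNeg q {{ℚ.nonNegative 0≤q}} q {{ℚ.nonNegative 0≤q}}}}
... | inj₂ q≤0 = ℚ.nonNegative⁻¹ _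
  {{ℚ.nonPos*nonPos⇒nonPos q {{ℚ.nonPositive q≤0}} q {{ℚ.nonPositive q≤0}}}}

p≤∣p∣ : ∀ p → p ℚ.≤ ∣ p ∣
p≤∣p∣ p with ℚ.≤-total 0ℚ p
... | inj₁ 0≤p = ℚ.≤-reflexive (sym (ℚ.0≤p⇒∣p∣≡p 0≤p))
... | inj₂ p≤0 = ℚ.≤-trans p≤0 (ℚ.0≤∣p∣ p)

-- Termwise comparison of reals

infix 4 _≐_

_≐_ : ℝ → ℝ → Set
x ≐ y = ∀ t → seq x t ≡ seq y t

≐⇒≈ : ∀ {x y} → x ≐ y → x ≈ y
≐⇒≈ {x} {y} x≐y {ε} 0<ε = 0 , λ {t} _ →
  subst (ℚ._< ε)
    (sym (cong ∣_∣ (trans (cong (ℚ._- seq y t) (x≐y t)) (ℚ.+-inverseʳ (seq y t))))) 0<ε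

≈-respˡ-≐ : ∀ {x y z} → x ≐ y → x ≈ z → y ≈ z
≈-respˡ-≐ {z = z} x≐y x≈z {ε} 0<ε =
  let N , h = x≈z 0<ε in
  N , λ {t} N≤t → subst (λ q → ∣ q ℚ.- seq z t ∣ ℚ.< ε) (x≐y t) (h N≤t)

≈-respʳ-≐ : ∀ {x y z} → y ≐ z → x ≈ y → x ≈ z
≈-respʳ-≐ {x = x} y≐z x≈y {ε} 0<ε =
  let N , h = x≈y 0<ε in
  N , λ {t} N≤t → subst (λ q → ∣ seq x t ℚ.- q ∣ ℚ.< ε) (y≐z t) (h N≤t)

termwise-nonNeg : ∀ {x} → (∀ t → 0ℚ ℚ.≤ seq x t) → 0ℝ ≤ x
termwise-nonNeg 0≤x 0<ε = 0 , λ {t} _ → ℚ.+-mono-≤ (0≤x t) (ℚ.<⇒≤ 0<ε)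

seq-sum : ∀ (f : Vector ℝ d) t → seq (sum f) t ≡ ℚ∑.sum (λ i → seq (f i) t)
seq-sum {ℕ.zero}  f t = refl
seq-sum {ℕ.suc d} f t = cong (seq (f zero) t ℚ.+_) (seq-sum (f ∘ suc) t)

seq-quad : ∀ (A : Matrix d d) x t →
  seq (quad A x) t ≡ ℚ∑.sum λ i → ℚ∑.sum λ j → seq (x i) t ℚ.* seq (A i j) t ℚ.* seq (x j) t
seq-quad A x t = trans (seq-sum (λ i → sum λ j → x i * A i j * x j) t)
  (ℚ∑.sum-cong-≗ λ i → seq-sum (λ j → x i * A i j * x j) t)

unit : Fin d → Vector ℝ d
unit p i = fromℚ (δ p i)

-- Reduces every evaluation at a separating vector to a single diagonal entry.
quad-unit : ∀ (A : Matrix d d) p → quad A (unit p) ≐ A p p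
quad-unit A p t = begin
  seq (quad A (unit p)) t
    ≡⟨ seq-quad A (unit p) t ⟩
  (ℚ∑.sum λ i → ℚ∑.sum λ j → δ p i ℚ.* seq (A i j) t ℚ.* δ p j)
    ≡⟨ ℚ∑.sum-cong-≗ (λ i → ∑-δʳ p (λ j → δ p i ℚ.* seq (A i j) t)) ⟩
  (ℚ∑.sum λ i → δ p i ℚ.* seq (A i p) t)
    ≡⟨ ∑-δˡ p (λ i → seq (A i p) t) ⟩
  seq (A p p) t ∎
  where open ≡-Reasoning

-- Coordinate projections

-- The sum of the outer products of the unit vectors at `σ m` with themselves. For injective `σ`
-- this is the orthogonal projection onto those coordinates; positive semidefiniteness holds for
-- every `σ`.
projectionℚ : (Fin r → Fin d) → Fin d → Fin d → ℚ
projectionℚ σ i j = ℚ∑.sum λ m → δ (σ m) i ℚ.* δ (σ m) j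

projection : (Fin r → Fin d) → Matrix d d
projection σ i j = fromℚ (projectionℚ σ i j)

-- After exchanging the sums, `δ (σ m) l` collapses the sum over `l`. Both the quadratic form and
-- the column space are computed from this.
projectionℚ-apply : ∀ (σ : Fin r → Fin d) (f : Vector ℚ d) i →
  ℚ∑.sum (λ l → f l ℚ.* projectionℚ σ i l) ≡ ℚ∑.sum (λ m → f (σ m) ℚ.* δ (σ m) i)
projectionℚ-apply σ f i = begin
  (ℚ∑.sum λ l → f l ℚ.* projectionℚ σ i l)
    ≡⟨ ℚ∑.sum-cong-≗ (λ l → ℚ∑.*-distribˡ-sum (f l) (λ m → δ (σ m) i ℚ.* δ (σ m) l)) ⟩
  (ℚ∑.sum λ l → ℚ∑.sum λ m → f l ℚ.* (δ (σ m) i ℚ.* δ (σ m) l))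
    ≡⟨ ℚ∑ᶜ.∑-comm (λ l m → f l ℚ.* (δ (σ m) i ℚ.* δ (σ m) l)) ⟩
  (ℚ∑.sum λ m → ℚ∑.sum λ l → f l ℚ.* (δ (σ m) i ℚ.* δ (σ m) l))
    ≡⟨ ℚ∑.sum-cong-≗ (λ m → ℚ∑.sum-cong-≗ λ l → sym (ℚ.*-assoc (f l) (δ (σ m) i) (δ (σ m) l))) ⟩
  (ℚ∑.sum λ m → ℚ∑.sum λ l → f l ℚ.* δ (σ m) i ℚ.* δ (σ m) l)
    ≡⟨ ℚ∑.sum-cong-≗ (λ m → ∑-δʳ (σ m) (λ l → f l ℚ.* δ (σ m) i)) ⟩
  (ℚ∑.sum λ m → f (σ m) ℚ.* δ (σ m) i) ∎
  where open ≡-Reasoning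

-- Exhibits the quadratic form as a sum of squares, whence its nonnegativity.
projectionℚ-quad : ∀ (σ : Fin r → Fin d) (f : Vector ℚ d) →
  (ℚ∑.sum λ i → ℚ∑.sum λ j → f i ℚ.* projectionℚ σ i j ℚ.* f j)
    ≡ ℚ∑.sum (λ m → f (σ m) ℚ.* f (σ m))
projectionℚ-quad σ f = begin
  (ℚ∑.sum λ i → ℚ∑.sum λ j → f i ℚ.* projectionℚ σ i j ℚ.* f j)
    ≡⟨ ℚ∑.sum-cong-≗ (λ i → ℚ∑.sum-cong-≗ λ j → rotate (f i) (projectionℚ σ i j) (f j)) ⟩
  (ℚ∑.sum λ i → ℚ∑.sum λ j → f i ℚ.* (f j ℚ.* projectionℚ σ i j))
    ≡⟨ ℚ∑.sum-cong-≗ (λ i → ℚ∑.*-distribˡ-sum (f i) (λ j → f j ℚ.* projectionℚ σ i j)) ⟨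
  (ℚ∑.sum λ i → f i ℚ.* ℚ∑.sum (λ j → f j ℚ.* projectionℚ σ i j))
    ≡⟨ ℚ∑.sum-cong-≗ (λ i → cong (f i ℚ.*_) (projectionℚ-apply σ f i)) ⟩
  (ℚ∑.sum λ i → f i ℚ.* ℚ∑.sum (λ m → f (σ m) ℚ.* δ (σ m) i))
    ≡⟨ ℚ∑.sum-cong-≗ (λ i → ℚ∑.*-distribˡ-sum (f i) (λ m → f (σ m) ℚ.* δ (σ m) i)) ⟩
  (ℚ∑.sum λ i → ℚ∑.sum λ m → f i ℚ.* (f (σ m) ℚ.* δ (σ m) i))
    ≡⟨ ℚ∑ᶜ.∑-comm (λ i m → f i ℚ.* (f (σ m) ℚ.* δ (σ m) i)) ⟩
  (ℚ∑.sum λ m → ℚ∑.sum λ i → f i ℚ.* (f (σ m) ℚ.* δ (σ m) i))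
    ≡⟨ ℚ∑.sum-cong-≗ (λ m → ℚ∑.sum-cong-≗ λ i → sym (ℚ.*-assoc (f i) (f (σ m)) (δ (σ m) i))) ⟩
  (ℚ∑.sum λ m → ℚ∑.sum λ i → f i ℚ.* f (σ m) ℚ.* δ (σ m) i)
    ≡⟨ ℚ∑.sum-cong-≗ (λ m → ∑-δʳ (σ m) (λ i → f i ℚ.* f (σ m))) ⟩
  (ℚ∑.sum λ m → f (σ m) ℚ.* f (σ m)) ∎
  where
  open ≡-Reasoning
  rotate : ∀ a b c → a ℚ.* b ℚ.* c ≡ a ℚ.* (c ℚ.* b)
  rotate = solve 3 (λ a b c → a :* b :* c := a :* (c :* b)) refl
    where open +-*-Solver

projection-positiveSemidefinite : (σ : Fin r → Fin d) → PositiveSemidefinite (projection σ)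
projection-positiveSemidefinite σ =
    (λ i j → ≐⇒≈ {projection σ i j} {projection σ j i} λ _ →
      ℚ∑.sum-cong-≗ λ m → ℚ.*-comm (δ (σ m) i) (δ (σ m) j))
  , λ x → termwise-nonNeg {quad (projection σ) x} λ t →
      subst (0ℚ ℚ.≤_)
        (sym (trans (seq-quad (projection σ) x t) (projectionℚ-quad σ (λ i → seq (x i) t))))
        (∑-nonNeg λ m → square-nonNeg (seq (x (σ m)) t))

-- By injectivity only the summand `l = m` survives, so the unit vectors at the selected coordinates
-- are themselves columns.
projectionℚ-column-image : {σ : Fin r → Fin d} → Injective _≡_ _≡_ σ →
  ∀ m i → projectionℚ σ i (σ m) ≡ δ (σ m) i
projectionℚ-column-image {σ = σ} σ-inj m i = trans
  (ℚ∑.sum-cong-≗ λ l → cong (δ (σ l) i ℚ.*_) (δ-injective σ-inj l m))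
  (∑-δʳ m (λ l → δ (σ l) i))

projection-hasRank : {σ : Fin r → Fin d} → Injective _≡_ _≡_ σ → HasRank (projection σ) r
projection-hasRank {r = r} {d = d} {σ = σ} σ-inj =
  basis , independent , inColumnSpace , λ {v} → spanning {v}
  where
  basis : Vector (Vector ℝ d) r
  basis j = unit (σ j)

  independent : LinearlyIndependent basis
  -- Coordinate `σ j` of the combination is exactly `c j`.
  independent c c≈0 j = ≈-respˡ-≐ {linComb c basis (σ j)} {c j} {0ℝ}
    (λ t → trans (seq-sum (λ m → c m * basis m (σ j)) t)
      (trans (ℚ∑.sum-cong-≗ λ m → cong (seq (c m) t ℚ.*_) (δ-injective σ-inj m j))
             (∑-δʳ j (λ m → seq (c m) t))))
    (c≈0 (σ j))

  inColumnSpace : ∀ j → basis j ∈ Span (transpose (projection σ))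
  -- The coefficient vector is the unit vector at `σ j`, which picks out column `σ j`, and that
  -- column is the same unit vector.
  inColumnSpace j = basis j , λ i →
    ≐⇒≈ {basis j i} {linComb (basis j) (transpose (projection σ)) i} λ t → sym (trans
      (seq-sum (λ l → basis j l * projection σ i l) t)
      (trans (∑-δˡ (σ j) (projectionℚ σ i)) (projectionℚ-column-image σ-inj j i)))

  spanning : Span (transpose (projection σ)) ⊆ Span basis
  -- Applying the projection to `c` keeps just its entries at the selected coordinates, so these are
  -- the new coefficients.
  spanning {v} (c , v≈) = c ∘ σ , λ i →
    ≈-respʳ-≐ {v i} {linComb c (transpose (projection σ)) i} {linComb (c ∘ σ) basis i}
      (λ t → trans (seq-sum (λ l → c l * projection σ i l) t)
        (trans (projectionℚ-apply σ (λ l → seq (c l) t) i)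
               (sym (seq-sum (λ m → c (σ m) * basis m i) t))))
      (v≈ i)

-- The 2n coordinates selected by the i-th projection

shift : Bool → Fin 2 → Fin 4
shift b a = if b then a ↑ˡ 2 else 2 ↑ʳ a

shift-injective : ∀ b {a a′ : Fin 2} → shift b a ≡ shift b a′ → a ≡ a′
shift-injective true  = ↑ˡ-injective 2 _ _
shift-injective false = ↑ʳ-injective 2 _ _

-- Each `j` contributes two coordinates, with first component in {0, 1} if `j` is `i` and in {2, 3}
-- otherwise; this makes the count 2n for every `i`.
place : Fin n → Fin 2 → Fin n → Fin (4 *ℕ n)
place i a j = combine (shift (does (i ≟ j)) a) j

-- The second component `j` is preserved, so equal images have equal `j` and hence use the same
-- branch of `shift`, which is injective.
place-injective : ∀ (i : Fin n) (a a′ : Fin 2) (j j′ : Fin n) →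
  place i a j ≡ place i a′ j′ → combine a j ≡ combine a′ j′
place-injective i a a′ j j′ eq
  with combine-injective (shift (does (i ≟ j)) a) j (shift (does (i ≟ j′)) a′) j′ eq
... | eq′ , refl = cong (λ c → combine c j) (shift-injective (does (i ≟ j)) {a} {a′} eq′)

coordinates : Fin n → Fin (2 *ℕ n) → Fin (4 *ℕ n)
coordinates {n} i k = uncurry (place i) (remQuot {2} n k)

coordinates-injective : (i : Fin n) → Injective _≡_ _≡_ (coordinates i)
coordinates-injective {n} i {k} {k′} eq = trans (sym (combine-remQuot {2} n k))
  (trans (place-injective i _ _ _ _ eq) (combine-remQuot {2} n k′))

-- Private coordinates and the diagonal entries there

private-coordinate : Fin n → Fin (4 *ℕ n)
private-coordinate i = combine {4} zero i

private-coordinate-own : (i : Fin n) → coordinates i (combine {2} zero i) ≡ private-coordinate i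
private-coordinate-own i = trans
  (cong (uncurry (place i)) (remQuot-combine {2} zero i))
  (cong (λ b → combine (shift b zero) i) (dec-true (i ≟ i) refl))

-- Equality would force `j` to be `i`; then `l ≢ i` makes the first component 2 or 3, whereas the
-- private coordinate has 0.
place-foreign : {i l : Fin n} → l ≢ i → ∀ a j → place l a j ≢ private-coordinate i
place-foreign {i = i} {l} l≢i a j eq
  with combine-injective (shift (does (l ≟ j)) a) j zero i eq
... | eq′ , refl with trans (sym (cong (λ b → shift b a) (dec-false (l ≟ i) l≢i))) eq′
... | ()

private-coordinate-foreign : {i l : Fin n} → l ≢ i → ∀ k → coordinates l k ≢ private-coordinate i
private-coordinate-foreign {n} l≢i k = uncurry (place-foreign l≢i) (remQuot {2} n k)

matrices : ∀ n → Vector (Matrix (4 *ℕ n) (4 *ℕ n)) n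
matrices n i = projection (coordinates i)

-- The private coordinate of `i` is selected by `coordinates i` and by no other `coordinates l`, so
-- in the second case every summand has a zero factor.
matrices-diag : ∀ (i l : Fin n) →
  projectionℚ (coordinates l) (private-coordinate i) (private-coordinate i) ≡ δ i l
matrices-diag i l with i ≟ l
... | yes refl = begin
  projectionℚ (coordinates i) p p
    ≡⟨ cong (projectionℚ (coordinates i) p) (private-coordinate-own i) ⟨
  projectionℚ (coordinates i) p (coordinates i (combine {2} zero i))
    ≡⟨ projectionℚ-column-image (coordinates-injective i) (combine {2} zero i) p ⟩
  δ (coordinates i (combine {2} zero i)) p
    ≡⟨ cong (λ q → δ q p) (private-coordinate-own i) ⟩
  δ p p
    ≡⟨ δ-refl p ⟩
  1ℚ ∎
  where
  open ≡-Reasoning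
  p = private-coordinate i
... | no i≢l = ∑-zero λ k → trans
  (cong (ℚ._* δ (coordinates l k) (private-coordinate i))
    (δ-≢ (private-coordinate-foreign (i≢l ∘ sym) k)))
  (ℚ.*-zeroˡ (δ (coordinates l k) (private-coordinate i)))

sum-matrices-diag : ∀ (i : Fin n) (μ : Vector ℝ n) →
  let p = private-coordinate i in sumᴹ (λ l → μ l ·ᴹ matrices n l) p p ≐ μ i
sum-matrices-diag {n} i μ t = trans
  (seq-sum (λ l → μ l * matrices n l p p) t)
  (trans (ℚ∑.sum-cong-≗ λ l → cong (seq (μ l) t ℚ.*_) (matrices-diag i l))
         (∑-δʳ i (λ l → seq (μ l) t)))
  where p = private-coordinate i

sum-matrices-diag-1 : ∀ (i : Fin n) →
  let p = private-coordinate i in sumᴹ (matrices n) p p ≐ 1ℝ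
sum-matrices-diag-1 {n} i t = trans
  (seq-sum (λ l → matrices n l p p) t)
  (trans (ℚ∑.sum-cong-≗ λ l → trans (matrices-diag i l) (sym (ℚ.*-identityˡ (δ i l))))
         (∑-δʳ i (λ _ → 1ℚ)))
  where p = private-coordinate i

quad-matrices-foreign : {i l : Fin n} → i ≢ l →
  quad (matrices n l) (unit (private-coordinate i)) ≐ 0ℝ
quad-matrices-foreign {n} {i} {l} i≢l t = trans
  (quad-unit (matrices n l) (private-coordinate i) t)
  (trans (matrices-diag i l) (δ-≢ i≢l))

quad-sum-matrices : (i : Fin n) →
  quad (sumᴹ (matrices n)) (unit (private-coordinate i)) ≐ 1ℝ
quad-sum-matrices {n} i t = trans
  (quad-unit (sumᴹ (matrices n)) (private-coordinate i) t) (sum-matrices-diag-1 i t)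

-- Nonvanishing of the weights

weight-lower-bound : ∀ ε μ (i : Fin n) →
  (1ℝ - ε) ·ᴹ sumᴹ (matrices n) ⪯ sumᴹ (λ l → μ l ·ᴹ matrices n l) →
  0ℝ ≤ μ i - (1ℝ - ε)
weight-lower-bound {n} ε μ i (_ , 0≤quad) {η} 0<η =
  let N , h = 0≤quad (unit p) 0<η in
  N , λ {t} N≤t → subst (λ q → 0ℚ ℚ.≤ q ℚ.+ η) (trans
    -- The tested matrix is an entrywise difference, so its diagonal entry already has the shape of
    -- the goal once the two sums are collapsed.
    (quad-unit (sumᴹ (λ l → μ l ·ᴹ matrices n l) -ᴹ (1ℝ - ε) ·ᴹ sumᴹ (matrices n)) p t)
    (cong₂ ℚ._-_ (sum-matrices-diag i μ t)
      (trans (cong ((1ℚ ℚ.- seq ε t) ℚ.*_) (sum-matrices-diag-1 i t))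
             (ℚ.*-identityʳ (1ℚ ℚ.- seq ε t))))) (h N≤t)
  where p = private-coordinate i

-- If `x` vanished, then `1ℝ - ε` would be at most zero, against the gap `η` between `ε` and 1. The
-- contradiction is drawn at one late index.
weight-nonzero : ∀ {ε x} → ε < 1ℝ → 0ℝ ≤ x - (1ℝ - ε) → ¬ (x ≈ 0ℝ)
weight-nonzero {ε} {x} (η , 0<η , K , ε+η≤1) 0≤x-1+ε x≈0 = ℚ.<-irrefl refl (begin-strict
  0ℚ
    ≤⟨ 0≤x-1+ε-at ⟩
  (xₜ ℚ.- (1ℚ ℚ.- εₜ)) ℚ.+ θ
    <⟨ ℚ.+-monoˡ-< θ (ℚ.+-monoˡ-< (ℚ.- (1ℚ ℚ.- εₜ)) xₜ<θ) ⟩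
  (θ ℚ.- (1ℚ ℚ.- εₜ)) ℚ.+ θ
    ≡⟨ regroup η εₜ ⟩
  (εₜ ℚ.+ η) ℚ.- 1ℚ
    ≤⟨ ℚ.+-monoˡ-≤ (ℚ.- 1ℚ) (ε+η≤1 K≤t) ⟩
  0ℚ ∎)
  where
  open ℚ.≤-Reasoning
  -- Half the gap, since it is spent twice: as the slack in `0≤x-1+ε` and as the bound on `xₜ`.
  θ = ½ ℚ.* η
  0<θ : 0ℚ ℚ.< θ
  0<θ = subst (ℚ._< θ) (ℚ.*-zeroʳ ½) (ℚ.*-monoʳ-<-pos ½ 0<η)
  L = proj₁ (0≤x-1+ε 0<θ)
  M = proj₁ (x≈0 0<θ)
  -- Past all three thresholds at once.
  t = K ℕ.⊔ (L ℕ.⊔ M)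
  K≤t = ℕ.m≤m⊔n K (L ℕ.⊔ M)
  xₜ = seq x t
  εₜ = seq ε t
  0≤x-1+ε-at = proj₂ (0≤x-1+ε 0<θ) (ℕ.≤-trans (ℕ.m≤m⊔n L M) (ℕ.m≤n⊔m K (L ℕ.⊔ M)))
  xₜ<θ : xₜ ℚ.< θ
  xₜ<θ = ℚ.≤-<-trans (p≤∣p∣ xₜ) (subst (λ q → ∣ q ∣ ℚ.< θ) (ℚ.+-identityʳ xₜ)
    (proj₂ (x≈0 0<θ) (ℕ.≤-trans (ℕ.m≤n⊔m L M) (ℕ.m≤n⊔m K (L ℕ.⊔ M)))))
  regroup : ∀ h e → (½ ℚ.* h ℚ.- (1ℚ ℚ.- e)) ℚ.+ ½ ℚ.* h ≡ (e ℚ.+ h) ℚ.- 1ℚ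
  regroup = solve 2 (λ h e →
    (con ½ :* h :- (con 1ℚ :- e)) :+ con ½ :* h := (e :+ h) :- con 1ℚ) refl
    where open +-*-Solver

theorem1p2 : ∀ (n : ℕ) → n ≥ℕ 3 →
    Σ[ A ∈ Vector (Matrix (4 *ℕ n) (4 *ℕ n)) n ]
    ( (∀ i → PositiveSemidefinite (A i) × HasRank (A i) (2 *ℕ n))
    × (∀ (S : Subset n) → S ⊂ₛ ⊤ →
    ∃[ x ] ((∀ i → i ∈ₛ S → quad (A i) x ≈ 0ℝ) × 0ℝ < quad (sumᴹ A) x))
    × (∀ (ε : ℝ) → ε < 1ℝ →
    ∀ (μ : Vector ℝ n) → (∀ i → 0ℝ ≤ μ i) → support μ ⊂ U →
    ¬ ( (1ℝ - ε) ·ᴹ sumᴹ A ⪯ sumᴹ (λ i → μ i ·ᴹ A i)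
    × sumᴹ (λ i → μ i ·ᴹ A i) ⪯ (1ℝ + ε) ·ᴹ sumᴹ A ) ) )
theorem1p2 n _ =
    matrices n
  , (λ i → projection-positiveSemidefinite (coordinates i)
         , projection-hasRank (coordinates-injective i))
  -- The proper inclusion `S ⊂ₛ ⊤` supplies the index `i` outside `S` whose private coordinate
  -- separates.
  , (λ { S (_ , i , _ , i∉S) → unit (private-coordinate i)
       , (λ l l∈S → ≐⇒≈ {quad (matrices n l) (unit (private-coordinate i))} {0ℝ}
            (quad-matrices-foreign {n} {i} {l} λ { refl → i∉S l∈S }))
       -- The form equals 1 in every term, so the gap 1 works from index 0 on.
       , 1ℚ , ℚ.positive⁻¹ 1ℚ , 0 , λ {t} _ → ℚ.≤-reflexive (sym (quad-sum-matrices i t)) })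
  -- Here properness is the negation of `U ⊆ support μ`, so it is refuted by showing every weight
  -- nonzero.
  , λ ε ε<1 μ _ suppμ⊂U (lower , _) → proj₂ suppμ⊂U λ {i} _ →
      weight-nonzero {ε} {μ i} ε<1 (weight-lower-bound ε μ i lower)
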